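{- Let $M$ be a matroid that is not OTE. Then $M$ is not sticky.
   Context: A modular cut of a matroid $M$ is a set $\mathcal{M}$ of flats of $M$ such that (1) if $F\in\mathcal{M}$ and $F'\supseteq F$ is a flat, then $F'\in\mathcal{M}$; (2) if $F_1,F_2\in\mathcal{M}$ and $(F_1,F_2)$ is a modular pair, i.e. $\operatorname{rk}(F_1)+\operatorname{rk}(F_2)=\operatorname{rk}(F_1\cup F_2)+\operatorname{rk}(F_1\cap F_2)$, then $F_1\cap F_2\in\mathcal{M}$. For a flat $F$, the principal modular cut is $\mathcal{M}_F=\{G: G \text{ a flat}, G\supseteq F\}$. A matroid is OTE if every modular cut other than the empty one is principal. An extension of a matroid $M$ on $E$ is a matroid $N$ on $F\supseteq E$ with $N|E=M$. If $N_1,N_2$ are extensions of $M$ on ground sets $F_1,F_2$ with $F_1\cap F_2=E$, an amalgam is a matroid on $F_1\cup F_2$ whose restriction to $F_i$ is $N_i$. $M$ is sticky if an amalgam exists for every such pair of extensions. -}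

module Defs where

open import Data.Nat using (ℕ; _+_; _≤_; _<_)
open import Data.Bool using (Bool; T)
open import Data.Fin using (Fin)
open import Data.Fin.Subset using (Subset; _∪_; _∩_; _⊆_; _∉_; ⁅_⁆; ∣_∣; ⊥)
open import Data.Vec using (_++_)
open import Data.Product using (Σ; ∃; _×_)
open import Relation.Binary.PropositionalEquality using (_≡_)
open import Relation.Nullary using (¬_)

record Matroid (n : ℕ) : Set where
  field
    rk      : Subset n → ℕ
    rk-card : ∀ X → rk X ≤ ∣ X ∣
    rk-mono : ∀ X Y → X ⊆ Y → rk X ≤ rk Y
    rk-sub  : ∀ X Y → rk (X ∪ Y) + rk (X ∩ Y) ≤ rk X + rk Y

open Matroid public

module _ {n : ℕ} (M : Matroid n) where

  IsFlat : Subset n → Set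
  IsFlat F = ∀ e → e ∉ F → rk M F < rk M (F ∪ ⁅ e ⁆)

  ModularPair : Subset n → Subset n → Set
  ModularPair F₁ F₂ = rk M F₁ + rk M F₂ ≡ rk M (F₁ ∪ F₂) + rk M (F₁ ∩ F₂)

  IsModularCut : (Subset n → Bool) → Set
  IsModularCut 𝓜 =
    (∀ F → T (𝓜 F) → IsFlat F) ×
    (∀ F F' → T (𝓜 F) → IsFlat F' → F ⊆ F' → T (𝓜 F')) ×
    (∀ F₁ F₂ → T (𝓜 F₁) → T (𝓜 F₂) → ModularPair F₁ F₂ → T (𝓜 (F₁ ∩ F₂)))

  IsEmptyCut : (Subset n → Bool) → Set
  IsEmptyCut 𝓜 = ∀ F → ¬ T (𝓜 F)

  IsPrincipal : (Subset n → Bool) → Set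
  IsPrincipal 𝓜 = Σ (Subset n) λ F → IsFlat F ×
    (∀ G → (T (𝓜 G) → IsFlat G × F ⊆ G) × (IsFlat G × F ⊆ G → T (𝓜 G)))

  OTE : Set
  OTE = ∀ 𝓜 → IsModularCut 𝓜 → ¬ IsEmptyCut 𝓜 → IsPrincipal 𝓜

IsExtension : {n k : ℕ} → Matroid n → Matroid (n + k) → Set
IsExtension {n} {k} M N = ∀ (X : Subset n) → rk N (X ++ ⊥ {k}) ≡ rk M X

-- Ground set of the amalgam: Fin ((n + k₁) + k₂) = E ⊎ (F₁ ∖ E) ⊎ (F₂ ∖ E).
IsAmalgam : {n k₁ k₂ : ℕ} → Matroid (n + k₁) → Matroid (n + k₂) →
            Matroid ((n + k₁) + k₂) → Set
IsAmalgam {n} {k₁} {k₂} N₁ N₂ A =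
  (∀ (Y : Subset (n + k₁)) → rk A (Y ++ ⊥ {k₂}) ≡ rk N₁ Y) ×
  (∀ (X : Subset n) (Z : Subset k₂) → rk A ((X ++ ⊥ {k₁}) ++ Z) ≡ rk N₂ (X ++ Z))

Sticky : {n : ℕ} → Matroid n → Set
Sticky {n} M = ∀ (k₁ k₂ : ℕ) (N₁ : Matroid (n + k₁)) (N₂ : Matroid (n + k₂)) →
  IsExtension M N₁ → IsExtension M N₂ →
  ∃ λ (A : Matroid ((n + k₁) + k₂)) → IsAmalgam {n} {k₁} {k₂} N₁ N₂ A

{-# OPTIONS --safe #-}
module Submission where

-- If X and Y lie in a modular cut 𝓜 and X ∩ Y does not, then M has an extension by one point e in
-- cl X and cl Y but not in cl (X ∩ Y). On the other hand, M has an extension N such that, in every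
-- further extension, cl X and cl Y meet only in cl (X ∩ Y); so the two have no amalgam. To build N,
-- add free elements that make X and Y hyperplanes, and induct on their modular defect. If it is
-- positive, add disjoint pairs L₁, L₂ with X ∪ Lᵢ and Y ∪ Lᵢ hyperplanes of defect one less and
-- rk ((X ∩ Y) ∪ L₁ ∪ L₂) = rk (X ∩ Y) + 4, as in the Vámos matroid. By induction a common point lies
-- in cl ((X ∩ Y) ∪ L₁) and in cl ((X ∩ Y) ∪ L₂), which meet in cl (X ∩ Y). The rank goes up at each
-- step, so all pairs of one level of the resulting binary tree are treated simultaneously.

open import Defs
open import Data.Bool using (Bool; true; false; T; T?; _∨_; _∧_)
open import Data.Empty renaming (⊥ to Empty) using ()
open import Data.Fin using (Fin; zero; suc; _↑ˡ_; _↑ʳ_; splitAt)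
open import Data.Fin.Properties using (any?; splitAt-↑ˡ; splitAt-↑ʳ) renaming (_≟_ to _≟ᶠ_)
open import Data.Fin.Subset
  using (Subset; inside; outside; _∪_; _∩_; _∉_; _⊆_; ⊥; ⊤; ⁅_⁆; ∣_∣)
open import Data.Fin.Subset.Properties
open import Data.Nat using (ℕ; zero; suc; _+_; _*_; _∸_; _⊓_; _≤_; _<_; z≤n; s≤s; _≤?_)
open import Data.Nat.Properties
open import Data.Nat.Solver using (module +-*-Solver)
open import Data.Product using (Σ; ∃; _×_; _,_; proj₁; proj₂)
open import Data.Sum using (_⊎_; inj₁; inj₂; [_,_]′)
open import Data.Vec using ([]; _∷_; _++_; take; drop; here; there)
open import Data.Vec.Properties using (take-zipWith; drop-zipWith; take++drop≡id)
open import Function using (_∘_; id; case_of_)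
open import Relation.Binary.PropositionalEquality
open import Relation.Nullary using (¬_; Dec; yes; no; contradiction; ¬?; _×-dec_; _⊎-dec_)
open import Relation.Nullary.Decidable using (decidable-stable; map′)

private variable
  n m s k p : ℕ

-- Finite sets and concatenated ground sets

∪-lub : {A B C : Subset n} → A ⊆ C → B ⊆ C → A ∪ B ⊆ C
∪-lub {A = A} {B} A⊆C B⊆C x∈ = [ A⊆C , B⊆C ]′ (x∈p∪q⁻ A B x∈)

∩-glb : {A B C : Subset n} → C ⊆ A → C ⊆ B → C ⊆ A ∩ B
∩-glb C⊆A C⊆B x∈ = x∈p∩q⁺ (C⊆A x∈ , C⊆B x∈)

∪-mono : {A B A′ B′ : Subset n} → A ⊆ A′ → B ⊆ B′ → A ∪ B ⊆ A′ ∪ B′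
∪-mono A⊆ B⊆ = ∪-lub (⊆-trans A⊆ (p⊆p∪q _)) (⊆-trans B⊆ (q⊆p∪q _ _))

∩-mono : {A B A′ B′ : Subset n} → A ⊆ A′ → B ⊆ B′ → A ∩ B ⊆ A′ ∩ B′
∩-mono {A = A} {B} A⊆ B⊆ = ∩-glb (⊆-trans (p∩q⊆p A B) A⊆) (⊆-trans (p∩q⊆q A B) B⊆)

∣∪∣+∣∩∣ : (A B : Subset n) → ∣ A ∪ B ∣ + ∣ A ∩ B ∣ ≡ ∣ A ∣ + ∣ B ∣
∣∪∣+∣∩∣ []            []            = refl
∣∪∣+∣∩∣ (outside ∷ A) (outside ∷ B) = ∣∪∣+∣∩∣ A B
∣∪∣+∣∩∣ (outside ∷ A) (inside  ∷ B) = trans (cong suc (∣∪∣+∣∩∣ A B)) (sym (+-suc ∣ A ∣ ∣ B ∣))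
∣∪∣+∣∩∣ (inside  ∷ A) (outside ∷ B) = cong suc (∣∪∣+∣∩∣ A B)
∣∪∣+∣∩∣ (inside  ∷ A) (inside  ∷ B) = cong suc
  (trans (+-suc _ _) (trans (cong suc (∣∪∣+∣∩∣ A B)) (sym (+-suc ∣ A ∣ ∣ B ∣))))

⊆∧∣∣≤⇒⊇ : {A B : Subset n} → A ⊆ B → ∣ B ∣ ≤ ∣ A ∣ → B ⊆ A
⊆∧∣∣≤⇒⊇ {A = A} A⊆B B≤A {x} x∈B with x ∈? A
... | yes x∈A = x∈A
... | no  x∉A = contradiction (p⊂q⇒∣p∣<∣q∣ (A⊆B , x , x∈B , x∉A)) (≤⇒≯ B≤A)

∣++∣ : (A : Subset n) (S : Subset s) → ∣ A ++ S ∣ ≡ ∣ A ∣ + ∣ S ∣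
∣++∣ []            S = refl
∣++∣ (outside ∷ A) S = ∣++∣ A S
∣++∣ (inside  ∷ A) S = cong suc (∣++∣ A S)

++-∪ : (A B : Subset n) {S U : Subset s} → (A ++ S) ∪ (B ++ U) ≡ (A ∪ B) ++ (S ∪ U)
++-∪ []      []      = refl
++-∪ (a ∷ A) (b ∷ B) = cong (_ ∷_) (++-∪ A B)

++-∩ : (A B : Subset n) {S U : Subset s} → (A ++ S) ∩ (B ++ U) ≡ (A ∩ B) ++ (S ∩ U)
++-∩ []      []      = refl
++-∩ (a ∷ A) (b ∷ B) = cong (_ ∷_) (++-∩ A B)

take-++ : (A : Subset n) (S : Subset s) → take n (A ++ S) ≡ A
take-++ []      S = refl
take-++ (a ∷ A) S = cong (a ∷_) (take-++ A S)

drop-++ : (A : Subset n) (S : Subset s) → drop n (A ++ S) ≡ S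
drop-++ []      S = refl
drop-++ (a ∷ A) S = drop-++ A S

take-⊆ : ∀ n {V W : Subset (n + s)} → V ⊆ W → take n V ⊆ take n W
take-⊆ (suc n) {v ∷ V} {w ∷ W} V⊆W {zero} here with here ← V⊆W here = here
take-⊆ (suc n) {v ∷ V} {w ∷ W} V⊆W {suc x} (there x∈) = there (take-⊆ n (drop-∷-⊆ V⊆W) x∈)

drop-⊆ : ∀ n {V W : Subset (n + s)} → V ⊆ W → drop n V ⊆ drop n W
drop-⊆ zero                      V⊆W = V⊆W
drop-⊆ (suc n) {v ∷ V} {w ∷ W}   V⊆W = drop-⊆ n (drop-∷-⊆ V⊆W)

++-⊆ : {A B : Subset n} {S U : Subset s} → A ⊆ B → S ⊆ U → A ++ S ⊆ B ++ U
++-⊆ {A = []}    {[]}    A⊆B S⊆U = S⊆U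
++-⊆ {A = a ∷ A} {b ∷ B} A⊆B S⊆U {zero}  here with here ← A⊆B here = here
++-⊆ {A = a ∷ A} {b ∷ B} A⊆B S⊆U {suc x} (there x∈) = there (++-⊆ (drop-∷-⊆ A⊆B) S⊆U x∈)

++-⊆⁻ : {A B : Subset n} {S U : Subset s} → A ++ S ⊆ B ++ U → A ⊆ B × S ⊆ U
++-⊆⁻ {n = n} {A = A} {B} {S} {U} AS⊆BU =
  subst₂ _⊆_ (take-++ A S) (take-++ B U) (take-⊆ n AS⊆BU) ,
  subst₂ _⊆_ (drop-++ A S) (drop-++ B U) (drop-⊆ n AS⊆BU)

-- Matroids on a ground set in two parts; adding free elements

module _ (ρ : Subset n → Subset s → ℕ)
  (ρ-card : ∀ A S → ρ A S ≤ ∣ A ∣ + ∣ S ∣)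
  (ρ-mono : ∀ {A B S U} → A ⊆ B → S ⊆ U → ρ A S ≤ ρ B U)
  (ρ-sub  : ∀ A B S U → ρ (A ∪ B) (S ∪ U) + ρ (A ∩ B) (S ∩ U) ≤ ρ A S + ρ B U)
  where

  ρ-matroid : Matroid (n + s)
  ρ-matroid .rk W = ρ (take n W) (drop n W)
  ρ-matroid .rk-card W = begin
    ρ (take n W) (drop n W)           ≤⟨ ρ-card _ _ ⟩
    ∣ take n W ∣ + ∣ drop n W ∣       ≡⟨ ∣++∣ (take n W) (drop n W) ⟨
    ∣ take n W ++ drop n W ∣          ≡⟨ cong ∣_∣ (take++drop≡id n W) ⟩
    ∣ W ∣                             ∎
    where open ≤-Reasoning
  ρ-matroid .rk-mono V W V⊆W = ρ-mono (take-⊆ n V⊆W) (drop-⊆ n V⊆W)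
  ρ-matroid .rk-sub V W
    rewrite take-zipWith {m = n} _∨_ V W | drop-zipWith {m = n} _∨_ V W
          | take-zipWith {m = n} _∧_ V W | drop-zipWith {m = n} _∧_ V W
    = ρ-sub (take n V) (take n W) (drop n V) (drop n W)

  rk-ρ-matroid : ∀ A S → rk ρ-matroid (A ++ S) ≡ ρ A S
  rk-ρ-matroid A S = cong₂ ρ (take-++ A S) (drop-++ A S)

+-interchange : ∀ a b c d → (a + b) + (c + d) ≡ (a + c) + (b + d)
+-interchange = solve 4 (λ a b c d → (a :+ b) :+ (c :+ d) := (a :+ c) :+ (b :+ d)) refl
  where open +-*-Solver

_⊕free_ : Matroid n → ∀ s → Matroid (n + s)
M ⊕free s = ρ-matroid (λ A S → rk M A + ∣ S ∣)
  (λ A S → +-monoˡ-≤ ∣ S ∣ (rk-card M A))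
  (λ A⊆B S⊆U → +-mono-≤ (rk-mono M _ _ A⊆B) (p⊆q⇒∣p∣≤∣q∣ S⊆U))
  (λ A B S U → begin
    (rk M (A ∪ B) + ∣ S ∪ U ∣) + (rk M (A ∩ B) + ∣ S ∩ U ∣)
      ≡⟨ +-interchange (rk M (A ∪ B)) _ _ _ ⟩
    (rk M (A ∪ B) + rk M (A ∩ B)) + (∣ S ∪ U ∣ + ∣ S ∩ U ∣)
      ≤⟨ +-mono-≤ (rk-sub M A B) (≤-reflexive (∣∪∣+∣∩∣ S U)) ⟩
    (rk M A + rk M B) + (∣ S ∣ + ∣ U ∣)
      ≡⟨ +-interchange (rk M A) _ _ _ ⟩
    (rk M A + ∣ S ∣) + (rk M B + ∣ U ∣) ∎)
  where open ≤-Reasoning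

rk-⊕free : (M : Matroid n) (A : Subset n) (S : Subset s) → rk (M ⊕free s) (A ++ S) ≡ rk M A + ∣ S ∣
rk-⊕free M A S = cong₂ (λ B U → rk M B + ∣ U ∣) (take-++ A S) (drop-++ A S)

-- Closed sets, and truncations with prescribed hyperplanes

-- A set-wise form of flatness, equivalent to `IsFlat` by `flat⇒closed` and `closed⇒flat`. It passes
-- to intersections, free extensions and truncations without adding elements one at a time.
Closed : Matroid n → Subset n → Set
Closed M X = ∀ {A B} → A ⊆ B → A ⊆ X → rk M B ≤ rk M A → B ⊆ X

-- Rank in `M` and number of free elements are both monotone, so if their sum does not grow from `V`
-- to `W`, neither of them does.
closed-⊕free : (M : Matroid n) {X : Subset n} → Closed M X → (S : Subset s) →
               Closed (M ⊕free s) (X ++ S)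
closed-⊕free {n} {s} M {X} X-closed S {V} {W} V⊆W V⊆XS W≤V =
  subst (_⊆ X ++ S) (take++drop≡id n W)
    (++-⊆ (X-closed (take-⊆ n V⊆W) V⊆X (≮⇒≥ λ lt → <⇒≱ (+-mono-<-≤ lt ∣V∣≤∣W∣) W≤V))
          (⊆-trans (⊆∧∣∣≤⇒⊇ (drop-⊆ n V⊆W) (≮⇒≥ λ lt → <⇒≱ (+-mono-≤-< rV≤rW lt) W≤V)) V⊆S))
  where
  V⊆X : take n V ⊆ X
  V⊆X = subst (take n V ⊆_) (take-++ X S) (take-⊆ n V⊆XS)
  V⊆S : drop n V ⊆ S
  V⊆S = subst (drop n V ⊆_) (drop-++ X S) (drop-⊆ n V⊆XS)
  rV≤rW : rk M (take n V) ≤ rk M (take n W)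
  rV≤rW = rk-mono M _ _ (take-⊆ n V⊆W)
  ∣V∣≤∣W∣ : ∣ drop n V ∣ ≤ ∣ drop n W ∣
  ∣V∣≤∣W∣ = p⊆q⇒∣p∣≤∣q∣ (drop-⊆ n V⊆W)

-- Truncation of G to rank suc k, in which every C j is made a hyperplane.
module Paving (G : Matroid n) (k : ℕ) {J : Set} (C : J → Subset n)
  (covered? : ∀ A → Dec (∃ λ j → A ⊆ C j))
  (C-closed : ∀ j → Closed G (C j))
  (C-meet   : ∀ i j → i ≡ j ⊎ rk G (C i ∩ C j) < k)
  where

  cap : Subset n → ℕ
  cap A with covered? A
  ... | yes _ = k
  ... | no  _ = suc k

  cap-covered : ∀ {A} j → A ⊆ C j → cap A ≡ k
  cap-covered {A} j A⊆C with covered? A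
  ... | yes _ = refl
  ... | no ¬c = contradiction (j , λ {x} → A⊆C {x}) ¬c

  cap-uncovered : ∀ {A} → ¬ (∃ λ j → A ⊆ C j) → cap A ≡ suc k
  cap-uncovered {A} ¬c with covered? A
  ... | yes c = contradiction c ¬c
  ... | no  _ = refl

  cap≤1+k : ∀ A → cap A ≤ suc k
  cap≤1+k A with covered? A
  ... | yes _ = n≤1+n k
  ... | no  _ = ≤-refl

  k≤cap : ∀ A → k ≤ cap A
  k≤cap A with covered? A
  ... | yes _ = ≤-refl
  ... | no  _ = n≤1+n k

  cap-mono : ∀ {A B} → A ⊆ B → cap A ≤ cap B
  cap-mono {A} {B} A⊆B with covered? B
  ... | yes (j , B⊆C) = ≤-reflexive (cap-covered j (⊆-trans A⊆B B⊆C))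
  ... | no  _         = cap≤1+k A

  f : Subset n → ℕ
  f A = rk G A ⊓ cap A

  f≤rk : ∀ A → f A ≤ rk G A
  f≤rk A = m⊓n≤m (rk G A) (cap A)

  f≤cap : ∀ A → f A ≤ cap A
  f≤cap A = m⊓n≤n (rk G A) (cap A)

  f≤1+k : ∀ A → f A ≤ suc k
  f≤1+k A = ≤-trans (f≤cap A) (cap≤1+k A)

  f≤k : ∀ {A} j → A ⊆ C j → f A ≤ k
  f≤k {A} j A⊆C = ≤-trans (f≤cap A) (≤-reflexive (cap-covered j A⊆C))

  -- For `A ⊆ C j` the bound `suc k` on `f (A ∪ B)` is one too large. Either `B` is spanned by
  -- `A ∩ B`, hence lies in `C j` as well and the union is covered, or `rk G (A ∩ B)` is below
  -- `rk G B`, which makes up for the one.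
  sub-cap-rk : ∀ A B → f (A ∪ B) + f (A ∩ B) ≤ cap A + rk G B
  sub-cap-rk A B with covered? A
  ... | no  _ = +-mono-≤ (f≤1+k (A ∪ B))
                  (≤-trans (f≤rk (A ∩ B)) (rk-mono G _ _ (p∩q⊆q A B)))
  ... | yes (j , A⊆C) with rk G B ≤? rk G (A ∩ B)
  ...   | yes le = +-mono-≤
            (f≤k j (∪-lub A⊆C (C-closed j (p∩q⊆q A B) (⊆-trans (p∩q⊆p A B) A⊆C) le)))
            (≤-trans (f≤rk (A ∩ B)) (rk-mono G _ _ (p∩q⊆q A B)))
  ...   | no  ≰  = begin
            f (A ∪ B) + f (A ∩ B)   ≤⟨ +-mono-≤ (f≤1+k (A ∪ B)) (f≤rk (A ∩ B)) ⟩
            suc k + rk G (A ∩ B)    ≡⟨ +-suc k _ ⟨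
            k + suc (rk G (A ∩ B))  ≤⟨ +-monoʳ-≤ k (≰⇒> ≰) ⟩
            k + rk G B              ∎
            where open ≤-Reasoning

  -- If one index covers both sets, it covers their union. For two different indices, `C-meet`
  -- pushes `rk G (A ∩ B)` below `k` and so pays for the `suc k` of the union.
  sub-cap-cap : ∀ A B → f (A ∪ B) + f (A ∩ B) ≤ cap A + cap B
  sub-cap-cap A B with covered? A
  ... | no  _ = +-mono-≤ (f≤1+k (A ∪ B))
                  (≤-trans (f≤cap (A ∩ B)) (cap-mono (p∩q⊆q A B)))
  ... | yes (i , A⊆Ci) with covered? B
  ...   | no  _ = ≤-trans (+-mono-≤ (f≤1+k (A ∪ B)) (f≤k i (⊆-trans (p∩q⊆p A B) A⊆Ci)))
                    (≤-reflexive (+-comm (suc k) k))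
  ...   | yes (j , B⊆Cj) with C-meet i j
  ...     | inj₁ refl = +-mono-≤ (f≤k i (∪-lub A⊆Ci B⊆Cj))
                          (f≤k i (⊆-trans (p∩q⊆p A B) A⊆Ci))
  ...     | inj₂ lt   = begin
            f (A ∪ B) + f (A ∩ B)     ≤⟨ +-mono-≤ (f≤1+k (A ∪ B)) (f≤rk (A ∩ B)) ⟩
            suc k + rk G (A ∩ B)      ≡⟨ +-suc k _ ⟨
            k + suc (rk G (A ∩ B))    ≤⟨ +-monoʳ-≤ k (≤-<-trans (rk-mono G _ _ (∩-mono A⊆Ci B⊆Cj)) lt) ⟩
            k + k                     ∎
            where open ≤-Reasoning

  f-sub : ∀ A B → f (A ∪ B) + f (A ∩ B) ≤ f A + f B
  -- The cases are which term of each minimum is attained at `A` and at `B`.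
  f-sub A B with ⊓-sel (rk G A) (cap A) | ⊓-sel (rk G B) (cap B)
  ... | inj₁ a | inj₁ b rewrite a | b =
        ≤-trans (+-mono-≤ (f≤rk (A ∪ B)) (f≤rk (A ∩ B))) (rk-sub G A B)
  ... | inj₂ a | inj₁ b rewrite a | b = sub-cap-rk A B
  ... | inj₂ a | inj₂ b rewrite a | b = sub-cap-cap A B
  ... | inj₁ a | inj₂ b rewrite a | b
        = subst₂ _≤_ (cong₂ (λ U V → f U + f V) (∪-comm B A) (∩-comm B A)) (+-comm (cap B) (rk G A))
            (sub-cap-rk B A)

  paved : Matroid n
  paved .rk            = f
  paved .rk-card A     = ≤-trans (f≤rk A) (rk-card G A)
  paved .rk-mono A B ⊆ = ⊓-mono-≤ (rk-mono G A B ⊆) (cap-mono ⊆)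
  paved .rk-sub        = f-sub

  paved-small : ∀ {A} → rk G A ≤ k → f A ≡ rk G A
  paved-small {A} le = m≤n⇒m⊓n≡m (≤-trans le (k≤cap A))

  -- Only sets `B` of rank above `k` in `G` are affected by the truncation. If `B` is uncovered,
  -- `f B` is `suc k`, too large for `f A`. If `B ⊆ C j`, then `f B` is `k`, so `A` has rank at
  -- least `k` inside `D ∩ C j`, which forces `D` to be `C j`.
  paved-closed : ∀ {D} → Closed G D → (∀ {A} → A ⊆ D → f A ≤ k) →
                 (∀ j → D ≡ C j ⊎ rk G (D ∩ C j) < k) → Closed paved D
  paved-closed {D} D-closed f≤ D-meet {A} {B} A⊆B A⊆D fB≤fA with rk G B ≤? k
  ... | yes rB≤k = D-closed A⊆B A⊆D
        (≤-trans (≤-reflexive (sym (paved-small rB≤k))) (≤-trans fB≤fA (f≤rk A)))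
  ... | no  rB≰k = by-cover (covered? B)
    where
    by-cover : Dec (∃ λ j → B ⊆ C j) → B ⊆ D
    by-cover (no ¬c) = contradiction (f≤ A⊆D)
      (<⇒≱ (<-≤-trans (⊓-glb (≰⇒> rB≰k) (≤-reflexive (sym (cap-uncovered ¬c)))) fB≤fA))
    by-cover (yes (j , B⊆C)) with D-meet j
    ... | inj₁ refl = B⊆C
    ... | inj₂ lt   = contradiction
      (≤-trans (⊓-glb (<⇒≤ (≰⇒> rB≰k)) (k≤cap B)) (≤-trans fB≤fA (f≤rk A)))
      (<⇒≱ (≤-<-trans (rk-mono G _ _ (∩-glb A⊆D (⊆-trans A⊆B B⊆C))) lt))

-- Disjoint pairs of new elements

block : ∀ q → Fin q → Subset (q * 2)
block (suc q) zero    = inside  ∷ inside  ∷ ⊥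
block (suc q) (suc i) = outside ∷ outside ∷ block q i

∣block∣ : ∀ q (i : Fin q) → ∣ block q i ∣ ≡ 2
∣block∣ (suc q) zero    = cong (2 +_) (∣⊥∣≡0 (q * 2))
∣block∣ (suc q) (suc i) = ∣block∣ q i

block-disjoint : ∀ q {i j : Fin q} → i ≢ j → block q i ∩ block q j ≡ ⊥
block-disjoint (suc q) {zero}  {zero}  i≢j = contradiction refl i≢j
block-disjoint (suc q) {zero}  {suc j} i≢j = cong (λ B → outside ∷ outside ∷ B) (∩-zeroˡ (block q j))
block-disjoint (suc q) {suc i} {zero}  i≢j = cong (λ B → outside ∷ outside ∷ B) (∩-zeroʳ (block q i))
block-disjoint (suc q) {suc i} {suc j} i≢j =
  cong (λ B → outside ∷ outside ∷ B) (block-disjoint q (i≢j ∘ cong suc))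

∣block∪block∣ : ∀ q {i j : Fin q} → i ≢ j → ∣ block q i ∪ block q j ∣ ≡ 4
∣block∪block∣ q {i} {j} i≢j = begin
  ∣ block q i ∪ block q j ∣                              ≡⟨ +-identityʳ _ ⟨
  ∣ block q i ∪ block q j ∣ + 0                          ≡⟨ cong (∣ block q i ∪ block q j ∣ +_) disjoint ⟨
  ∣ block q i ∪ block q j ∣ + ∣ block q i ∩ block q j ∣  ≡⟨ ∣∪∣+∣∩∣ (block q i) (block q j) ⟩
  ∣ block q i ∣ + ∣ block q j ∣                          ≡⟨ cong₂ _+_ (∣block∣ q i) (∣block∣ q j) ⟩
  4                                                      ∎
  where
  open ≡-Reasoning
  disjoint : ∣ block q i ∩ block q j ∣ ≡ 0
  disjoint = trans (cong ∣_∣ (block-disjoint q i≢j)) (∣⊥∣≡0 (q * 2))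

-- Extensions and their composition

-- The size is tied to `n + k` by an equation because an extension of an extension has a ground set
-- of size `n + k + s`, which is not `n + (k + s)` by definition.
pad : n + k ≡ m → Subset n → Subset m
pad refl X = X ++ ⊥

pad-∪ : (e : n + k ≡ m) (A B : Subset n) → pad e (A ∪ B) ≡ pad e A ∪ pad e B
pad-∪ refl A B = sym (trans (++-∪ A B) (cong ((A ∪ B) ++_) (∪-idem ⊥)))

pad-∩ : (e : n + k ≡ m) (A B : Subset n) → pad e (A ∩ B) ≡ pad e A ∩ pad e B
pad-∩ refl A B = sym (trans (++-∩ A B) (cong ((A ∩ B) ++_) (∩-idem ⊥)))

pad-⊆ : (e : n + k ≡ m) {A B : Subset n} → A ⊆ B → pad e A ⊆ pad e B
pad-⊆ refl A⊆B = ++-⊆ A⊆B ⊆-refl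

pad-∷ : (e : n + k ≡ m) (b : Bool) (X : Subset n) → pad (cong suc e) (b ∷ X) ≡ b ∷ pad e X
pad-∷ refl b X = refl

⊥-++ : ∀ k {s} → ⊥ {k + s} ≡ ⊥ {k} ++ ⊥ {s}
⊥-++ zero    = refl
⊥-++ (suc k) = cong (outside ∷_) (⊥-++ k)

-- The equation is built together with the property, by `cong suc` along `n`, so that `pad-∷` can
-- peel off one element at a time; likewise in `pad-assoc`.
pad-id : ∀ n → Σ (n + 0 ≡ n) λ e → ∀ X → pad e X ≡ X
pad-id zero    = refl , λ { [] → refl }
pad-id (suc n) with e , pad-e ← pad-id n =
  cong suc e , λ { (b ∷ X) → trans (pad-∷ e b X) (cong (b ∷_) (pad-e X)) }

pad-assoc : ∀ n k {s} → Σ (n + (k + s) ≡ n + k + s) λ e → ∀ X → pad e X ≡ (X ++ ⊥ {k}) ++ ⊥ {s}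
pad-assoc zero    k = refl , λ { [] → ⊥-++ k }
pad-assoc (suc n) k with e , pad-e ← pad-assoc n k =
  cong suc e , λ { (b ∷ X) → trans (pad-∷ e b X) (cong (b ∷_) (pad-e X)) }

record Extends (M : Matroid n) (N : Matroid m) : Set where
  constructor extends
  field
    {width} : ℕ
    size    : n + width ≡ m
    rk-pad  : ∀ X → rk N (pad size X) ≡ rk M X

  ι : Subset n → Subset m
  ι = pad size

open Extends

Extends-refl : (M : Matroid n) → Σ (Extends M M) λ E → ∀ X → ι E X ≡ X
Extends-refl {n} M with e , pad-e ← pad-id n = extends e (λ X → cong (rk M) (pad-e X)) , pad-e

Extends-trans : {M : Matroid n} {N : Matroid m} {P : Matroid p} (D : Extends M N) (E : Extends N P) →
                Σ (Extends M P) λ F → ∀ X → ι F X ≡ ι E (ι D X)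
Extends-trans {n = n} {P = P} (extends {k} refl rk-D) (extends refl rk-E) with e , pad-e ← pad-assoc n k =
  extends e (λ X → trans (cong (rk P) (pad-e X)) (trans (rk-E _) (rk-D X))) , pad-e

-- Added points and pairs of hyperplanes

-- Point M g: g behaves as A ↦ rk (A ∪ {e}) for one element e added to M,
-- so that g A ≤ rk M A says that e lies in the closure of A.
record Point (M : Matroid n) (g : Subset n → ℕ) : Set where
  field
    above : ∀ A → rk M A ≤ g A
    sub   : ∀ A B → g (A ∪ B) + g (A ∩ B) ≤ g A + g B
    mixed : ∀ {A B} → A ⊆ B → g B + rk M A ≤ g A + rk M B

open Point

_spanned-by_ : {M : Matroid n} {g : Subset n → ℕ} → Point M g → Subset n → Set
_spanned-by_ {M = M} {g} _ A = g A ≤ rk M A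

-- This is what `mixed` is for: it is submodularity at `A ∪ {e}` and `B`.
spanned-mono : {M : Matroid n} {g : Subset n → ℕ} (e : Point M g) {A B : Subset n} →
               A ⊆ B → e spanned-by A → e spanned-by B
spanned-mono {M = M} {g} e {A} {B} A⊆B gA≤ = +-cancelʳ-≤ (rk M A) (g B) (rk M B) (begin
  g B + rk M A     ≤⟨ mixed e A⊆B ⟩
  g A + rk M B     ≤⟨ +-monoˡ-≤ (rk M B) gA≤ ⟩
  rk M A + rk M B  ≡⟨ +-comm (rk M A) (rk M B) ⟩
  rk M B + rk M A  ∎)
  where open ≤-Reasoning

Point-restrict : {M : Matroid n} {N : Matroid m} (E : Extends M N) {g : Subset m → ℕ} →
                 Point N g → Point M (g ∘ ι E)
Point-restrict {N = N} (extends e rk-e) {g} P .above A = ≤-trans (≤-reflexive (sym (rk-e A))) (above P _)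
Point-restrict (extends e rk-e) {g} P .sub A B =
  subst₂ (λ U V → g U + g V ≤ g (pad e A) + g (pad e B)) (sym (pad-∪ e A B)) (sym (pad-∩ e A B))
    (sub P (pad e A) (pad e B))
Point-restrict (extends e rk-e) {g} P .mixed {A} {B} A⊆B =
  subst₂ (λ a b → g (pad e B) + a ≤ g (pad e A) + b) (rk-e A) (rk-e B) (mixed P (pad-⊆ e A⊆B))

-- δ is the modular defect r(X) + r(Y) − r(X ∪ Y) − r(X ∩ Y) of two hyperplanes in rank R.
record HyperplanePair (M : Matroid n) (R δ : ℕ) (X Y : Subset n) : Set where
  field
    X-closed : Closed M X
    Y-closed : Closed M Y
    rk-X     : suc (rk M X) ≡ R
    rk-Y     : suc (rk M Y) ≡ R
    Y⊈X      : ¬ Y ⊆ X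
    rk-X∩Y   : rk M (X ∩ Y) + (2 + δ) ≡ R

open HyperplanePair

Meets-in-closure : {M : Matroid n} {g : Subset n → ℕ} → Point M g → Subset n → Subset n → Set
Meets-in-closure e X Y = e spanned-by X → e spanned-by Y → e spanned-by (X ∩ Y)

-- At defect 0, `rk M Y` is one more than `rk M (X ∩ Y)`, while `g (X ∪ Y)` exceeds `rk M X` because
-- `X` is closed and does not contain `Y`. Submodularity of `g` leaves at most `rk M (X ∩ Y)` for
-- `g (X ∩ Y)`.
modular-meets : {M : Matroid n} {R : ℕ} {X Y : Subset n} → HyperplanePair M R 0 X Y →
                {g : Subset n → ℕ} (e : Point M g) → Meets-in-closure e X Y
modular-meets {M = M} {R} {X} {Y} H {g} e gX≤ gY≤ =
  ≤-pred (+-cancelˡ-≤ (suc (rk M X)) _ _ (begin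
    suc (rk M X) + suc (g (X ∩ Y))       ≡⟨ +-suc (suc (rk M X)) _ ⟩
    suc (suc (rk M X) + g (X ∩ Y))       ≤⟨ s≤s (+-monoˡ-≤ (g (X ∩ Y)) rX<gX∪Y) ⟩
    suc (g (X ∪ Y) + g (X ∩ Y))          ≤⟨ s≤s (sub e X Y) ⟩
    suc (g X + g Y)                      ≤⟨ s≤s (+-mono-≤ gX≤ gY≤) ⟩
    suc (rk M X) + rk M Y                ≡⟨ cong (suc (rk M X) +_) rY ⟩
    suc (rk M X) + suc (rk M (X ∩ Y))    ∎))
  where
  open ≤-Reasoning
  rX<gX∪Y : rk M X < g (X ∪ Y)
  rX<gX∪Y = <-≤-trans
    (≰⇒> λ le → Y⊈X H (⊆-trans (q⊆p∪q X Y) (X-closed H (p⊆p∪q Y) ⊆-refl le)))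
    (above e (X ∪ Y))
  rY : rk M Y ≡ suc (rk M (X ∩ Y))
  rY = suc-injective (trans (rk-Y H) (trans (sym (rk-X∩Y H)) (+-comm (rk M (X ∩ Y)) 2)))

-- A single extension serves the whole family, since later steps change the rank for all pairs at
-- once. A `Point` of `N` stands for a point of any further extension.
Separable : (M : Matroid n) (X Y : Fin p → Subset n) → Set
Separable M X Y = Σ ℕ λ m → Σ (Matroid m) λ N → Σ (Extends M N) λ E →
  ∀ {g} (e : Point N g) i → Meets-in-closure (Point-restrict E e) (X i) (Y i)

-- A separating extension of `N` also extends `M`, and its points restrict to `M` by way of `N`.
Separable-lift : {M : Matroid n} {N : Matroid m} (D : Extends M N)
  {X Y : Fin p → Subset n} {X′ Y′ : Fin k → Subset m} →
  (∀ {g} (e : Point N g) → (∀ j → Meets-in-closure e (X′ j) (Y′ j)) →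
    ∀ i → Meets-in-closure (Point-restrict D e) (X i) (Y i)) →
  Separable N X′ Y′ → Separable M X Y
Separable-lift {n = n} {M = M} D {X} {Y} descend (o , P , E , meets) =
  o , P , proj₁ F , λ {g} e i gX≤ gY≤ →
    subst (λ V → g V ≤ rk M (X i ∩ Y i)) (sym (ιF (X i ∩ Y i)))
      (descend (Point-restrict E e) (meets e) i
        (subst (λ V → g V ≤ rk M (X i)) (ιF (X i)) gX≤)
        (subst (λ V → g V ≤ rk M (Y i)) (ιF (Y i)) gY≤))
  where
  F : Σ (Extends M P) λ F → ∀ A → ι F A ≡ ι E (ι D A)
  F = Extends-trans D E
  ιF : ∀ A → ι (proj₁ F) A ≡ ι E (ι D A)
  ιF = proj₂ F

-- Lowering the defect by a Vámos-like construction

-- The two pairs replacing (X i , Y i) have the indices i ↑ˡ p and p ↑ʳ i.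
module Doubling {n p R δ : ℕ} (M : Matroid n) (rk≤R : ∀ A → rk M A ≤ R)
  (X Y : Fin p → Subset n) (H : ∀ i → HyperplanePair M R (suc δ) (X i) (Y i))
  where

  Q : ℕ
  Q = p + p

  origin : Fin Q → Fin p
  origin = [ id , id ]′ ∘ splitAt p

  L : Fin Q → Subset (Q * 2)
  L = block Q

  G : Matroid (n + Q * 2)
  G = M ⊕free (Q * 2)

  side : Bool → Fin p → Subset n
  side true  = X
  side false = Y

  C : Fin Q × Bool → Subset (n + Q * 2)
  C (j , b) = side b (origin j) ++ L j

  side-closed : ∀ b i → Closed M (side b i)
  side-closed true  i = X-closed (H i)
  side-closed false i = Y-closed (H i)

  rk-side : ∀ b i → suc (rk M (side b i)) ≡ R
  rk-side true  i = rk-X (H i)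
  rk-side false i = rk-Y (H i)

  rk-G-∩ : ∀ {A B} j → rk G ((A ++ L j) ∩ (B ++ L j)) ≡ rk M (A ∩ B) + 2
  rk-G-∩ {A} {B} j = begin
    rk G ((A ++ L j) ∩ (B ++ L j))   ≡⟨ cong (rk G) (++-∩ A B) ⟩
    rk G ((A ∩ B) ++ (L j ∩ L j))    ≡⟨ rk-⊕free M (A ∩ B) (L j ∩ L j) ⟩
    rk M (A ∩ B) + ∣ L j ∩ L j ∣     ≡⟨ cong (λ S → rk M (A ∩ B) + ∣ S ∣) (∩-idem (L j)) ⟩
    rk M (A ∩ B) + ∣ L j ∣           ≡⟨ cong (rk M (A ∩ B) +_) (∣block∣ Q j) ⟩
    rk M (A ∩ B) + 2                 ∎
    where open ≡-Reasoning

  rZ+2<R : ∀ i → rk M (X i ∩ Y i) + 2 < R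
  rZ+2<R i = ≤-trans (m≤m+n _ δ) (≤-reflexive (trans
    (solve 2 (λ z d → con 1 :+ (z :+ con 2) :+ d := z :+ (con 2 :+ (con 1 :+ d))) refl _ δ)
    (rk-X∩Y (H i))))
    where open +-*-Solver

  -- For the two sides of one block the meet has rank `rk M (X ∩ Y) + 2`, below `R` since the defect
  -- is positive. For different blocks the new elements drop out and the meet lies in a single side,
  -- of rank `R - 1`, even if both indices have the same origin.
  C-meet : ∀ i j → i ≡ j ⊎ rk G (C i ∩ C j) < R
  C-meet (i , a) (j , b) with i ≟ᶠ j
  C-meet (i , true)  (.i , true)  | yes refl = inj₁ refl
  C-meet (i , false) (.i , false) | yes refl = inj₁ refl
  C-meet (i , true)  (.i , false) | yes refl =
    inj₂ (subst (_< R) (sym (rk-G-∩ i)) (rZ+2<R (origin i)))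
  C-meet (i , false) (.i , true)  | yes refl =
    inj₂ (subst (_< R) (sym (trans (rk-G-∩ i) (cong (λ A → rk M A + 2) (∩-comm _ _)))) (rZ+2<R (origin i)))
  C-meet (i , a) (j , b) | no i≢j = inj₂ (begin-strict
    rk G (C (i , a) ∩ C (j , b))    ≡⟨ cong (rk G) (++-∩ A B) ⟩
    rk G ((A ∩ B) ++ (L i ∩ L j))   ≡⟨ rk-⊕free M (A ∩ B) (L i ∩ L j) ⟩
    rk M (A ∩ B) + ∣ L i ∩ L j ∣    ≡⟨ cong (λ S → rk M (A ∩ B) + ∣ S ∣) (block-disjoint Q i≢j) ⟩
    rk M (A ∩ B) + ∣ ⊥ {Q * 2} ∣    ≡⟨ cong (rk M (A ∩ B) +_) (∣⊥∣≡0 (Q * 2)) ⟩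
    rk M (A ∩ B) + 0                ≡⟨ +-identityʳ _ ⟩
    rk M (A ∩ B)                    ≤⟨ rk-mono M _ _ (p∩q⊆p A B) ⟩
    rk M A                          <⟨ ≤-reflexive (rk-side a (origin i)) ⟩
    R                               ∎)
    where
    open ≤-Reasoning
    A B : Subset n
    A = side a (origin i)
    B = side b (origin j)

  covered? : ∀ A → Dec (∃ λ j → A ⊆ C j)
  covered? A = map′
    (λ { (j , inj₁ A⊆) → (j , true) , λ {x} → A⊆ {x} ; (j , inj₂ A⊆) → (j , false) , λ {x} → A⊆ {x} })
    (λ { ((j , true) , A⊆) → j , inj₁ (λ {x} → A⊆ {x}) ; ((j , false) , A⊆) → j , inj₂ (λ {x} → A⊆ {x}) })
    (any? λ j → (A ⊆? C (j , true)) ⊎-dec (A ⊆? C (j , false)))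

  C-closed : ∀ j → Closed G (C j)
  C-closed (j , b) = closed-⊕free M (side-closed b (origin j)) (L j)

  open Paving G R C covered? C-closed C-meet

  N : Matroid (n + Q * 2)
  N = paved

  N-bound : ∀ A → rk N A ≤ suc R
  N-bound = f≤1+k

  rk-N-⊥ : ∀ A → rk N (A ++ ⊥) ≡ rk M A
  rk-N-⊥ A = trans (paved-small (≤-trans (≤-reflexive G-⊥) (rk≤R A))) G-⊥
    where
    G-⊥ : rk G (A ++ ⊥) ≡ rk M A
    G-⊥ = trans (rk-⊕free M A ⊥) (trans (cong (rk M A +_) (∣⊥∣≡0 (Q * 2))) (+-identityʳ _))

  M≼N : Extends M N
  M≼N = extends refl rk-N-⊥

  -- In `G` the rank is `(R - 1) + 2`; the cap takes away one. This loss is why the blocks have two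
  -- elements.
  rk-N-C : ∀ j → rk N (C j) ≡ R
  rk-N-C (j , b) = trans (cong₂ _⊓_ rk-G (cap-covered (j , b) ⊆-refl))
    (m≥n⇒m⊓n≡n (≤-trans (n≤1+n R) (≤-reflexive (trans (cong suc (sym (rk-side b _))) (+-comm 2 _)))))
    where
    rk-G : rk G (C (j , b)) ≡ rk M (side b (origin j)) + 2
    rk-G = trans (rk-⊕free M _ (L j)) (cong (rk M (side b (origin j)) +_) (∣block∣ Q j))

  rk-N-∩ : ∀ j → rk N (C (j , true) ∩ C (j , false)) ≡ rk M (X (origin j) ∩ Y (origin j)) + 2
  rk-N-∩ j = trans (paved-small (≤-trans (≤-reflexive (rk-G-∩ j)) (<⇒≤ (rZ+2<R _)))) (rk-G-∩ j)

  C-closed-N : ∀ j → Closed N (C j)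
  C-closed-N j = paved-closed (C-closed j) (f≤k j) (λ i → [ inj₁ ∘ cong C , inj₂ ]′ (C-meet j i))

  -- The total rank goes up by one and the rank of the meet by two, so the defect falls by one.
  doubled : ∀ j → HyperplanePair N (suc R) δ (C (j , true)) (C (j , false))
  doubled j .X-closed = C-closed-N (j , true)
  doubled j .Y-closed = C-closed-N (j , false)
  doubled j .rk-X     = cong suc (rk-N-C (j , true))
  doubled j .rk-Y     = cong suc (rk-N-C (j , false))
  doubled j .Y⊈X ⊆    = Y⊈X (H (origin j)) (proj₁ (++-⊆⁻ {S = L j} {L j} ⊆))
  doubled j .rk-X∩Y   = begin
    rk N (C (j , true) ∩ C (j , false)) + (2 + δ)  ≡⟨ cong (_+ (2 + δ)) (rk-N-∩ j) ⟩
    rk M Z + 2 + (2 + δ)                           ≡⟨ arith (rk M Z) δ ⟩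
    suc (rk M Z + (2 + suc δ))                     ≡⟨ cong suc (rk-X∩Y (H (origin j))) ⟩
    suc R                                          ∎
    where
    open ≡-Reasoning
    Z : Subset n
    Z = X (origin j) ∩ Y (origin j)
    arith : ∀ z d → z + 2 + (2 + d) ≡ suc (z + (2 + suc d))
    arith = solve 2 (λ z d → z :+ con 2 :+ (con 2 :+ d) := con 1 :+ (z :+ (con 2 :+ (con 1 :+ d)))) refl
      where open +-*-Solver

  ↑ˡ≢↑ʳ : ∀ (i j : Fin p) → i ↑ˡ p ≢ p ↑ʳ j
  ↑ˡ≢↑ʳ i j eq with () ← trans (sym (splitAt-↑ˡ p i p)) (trans (cong (splitAt p) eq) (splitAt-↑ʳ p p j))

  module _ {g : Subset (n + Q * 2) → ℕ} (e : Point N g)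
    (meets : ∀ j → Meets-in-closure e (C (j , true)) (C (j , false)))
    where

    e∣M : Point M (g ∘ ι M≼N)
    e∣M = Point-restrict M≼N e

    spanned-++L : ∀ {A} j → e∣M spanned-by A → e spanned-by (A ++ L j)
    spanned-++L {A} j gA≤ = spanned-mono e (++-⊆ {A = A} ⊆-refl (⊆-min (L j)))
      (≤-trans gA≤ (≤-reflexive (sym (rk-N-⊥ A))))

    g-Z-L : ∀ j → e∣M spanned-by X (origin j) → e∣M spanned-by Y (origin j) →
            g ((X (origin j) ∩ Y (origin j)) ++ L j) ≤ rk M (X (origin j) ∩ Y (origin j)) + 2
    g-Z-L j gX≤ gY≤ = subst₂ _≤_
      (cong g (trans (++-∩ (X (origin j)) (Y (origin j)))
        (cong ((X (origin j) ∩ Y (origin j)) ++_) (∩-idem (L j)))))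
      (rk-N-∩ j)
      (meets j (spanned-++L j gX≤) (spanned-++L j gY≤))

    -- There is room for all four new elements: `rk M (X i ∩ Y i) + 4 + δ` is `suc R`. The lower cap
    -- `R` does not apply, since every `C j` contains only two new elements.
    rk-Z-L-L : ∀ i {j₁ j₂} → j₁ ≢ j₂ → rk M (X i ∩ Y i) + 4 ≤ rk N ((X i ∩ Y i) ++ (L j₁ ∪ L j₂))
    rk-Z-L-L i {j₁} {j₂} j₁≢j₂ = ⊓-glb
      (≤-reflexive (sym (trans (rk-⊕free M _ _) (cong (rk M (X i ∩ Y i) +_) (∣block∪block∣ Q j₁≢j₂)))))
      (≤-trans (≤-trans (m≤m+n _ δ) (≤-reflexive (trans (arith (rk M (X i ∩ Y i)) δ) (cong suc (rk-X∩Y (H i))))))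
        (≤-reflexive (sym (cap-uncovered uncovered))))
      where
      arith : ∀ z d → z + 4 + d ≡ suc (z + (2 + suc d))
      arith = solve 2 (λ z d → z :+ con 4 :+ d := con 1 :+ (z :+ (con 2 :+ (con 1 :+ d)))) refl
        where open +-*-Solver
      uncovered : ¬ (∃ λ j → (X i ∩ Y i) ++ (L j₁ ∪ L j₂) ⊆ C j)
      uncovered ((j , b) , ⊆C) = case 4≤2 of λ { (s≤s (s≤s ())) }
        where
        4≤2 : 4 ≤ 2
        4≤2 = subst₂ _≤_ (∣block∪block∣ Q j₁≢j₂) (∣block∣ Q j)
          (p⊆q⇒∣p∣≤∣q∣ (proj₂ (++-⊆⁻ {A = X i ∩ Y i} {side b (origin j)} ⊆C)))

    -- The Vámos argument: `Z ∪ L₁` and `Z ∪ L₂` both span the point and have rank `rk M Z + 2`,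
    -- while their union has rank at least `rk M Z + 4`. Submodularity of `g` leaves at most
    -- `rk M Z` for their meet `Z`.
    skew-meets : ∀ i → Meets-in-closure e∣M (X i) (Y i)
    skew-meets i gX≤ gY≤ = +-cancelˡ-≤ (rk M Z + 4) _ _ (begin
      rk M Z + 4 + g (Z ++ ⊥)                          ≤⟨ +-monoˡ-≤ _ (≤-trans (rk-Z-L-L i j₁≢j₂) (above e _)) ⟩
      g (Z ++ (L j₁ ∪ L j₂)) + g (Z ++ ⊥)              ≡⟨ cong₂ (λ U V → g U + g V) union meet ⟨
      g (A ∪ B) + g (A ∩ B)                            ≤⟨ sub e A B ⟩
      g A + g B                                        ≤⟨ +-mono-≤ (g-Z-L-at j₁ origin₁) (g-Z-L-at j₂ origin₂) ⟩
      (rk M Z + 2) + (rk M Z + 2)                      ≡⟨ arith (rk M Z) ⟩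
      rk M Z + 4 + rk M Z                              ∎)
      where
      open ≤-Reasoning
      j₁ j₂ : Fin Q
      j₁ = i ↑ˡ p
      j₂ = p ↑ʳ i
      j₁≢j₂ : j₁ ≢ j₂
      j₁≢j₂ = ↑ˡ≢↑ʳ i i
      origin₁ : origin j₁ ≡ i
      origin₁ = cong [ id , id ]′ (splitAt-↑ˡ p i p)
      origin₂ : origin j₂ ≡ i
      origin₂ = cong [ id , id ]′ (splitAt-↑ʳ p p i)
      Z : Subset n
      Z = X i ∩ Y i
      A B : Subset (n + Q * 2)
      A = Z ++ L j₁
      B = Z ++ L j₂
      union : A ∪ B ≡ Z ++ (L j₁ ∪ L j₂)
      union = trans (++-∪ Z Z) (cong (_++ (L j₁ ∪ L j₂)) (∪-idem Z))
      meet : A ∩ B ≡ Z ++ ⊥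
      meet = trans (++-∩ Z Z) (cong₂ _++_ (∩-idem Z) (block-disjoint Q j₁≢j₂))
      g-Z-L-at : ∀ j → origin j ≡ i → g (Z ++ L j) ≤ rk M Z + 2
      g-Z-L-at j refl = g-Z-L j gX≤ gY≤
      arith : ∀ z → (z + 2) + (z + 2) ≡ z + 4 + z
      arith = solve 1 (λ z → (z :+ con 2) :+ (z :+ con 2) := z :+ con 4 :+ z) refl
        where open +-*-Solver

-- Induction on `δ`, with `M`, `R` and the length `p` of the family left free: each step replaces
-- `p` by `p + p` and `R` by `suc R`.
hyperplane-pairs-separable : ∀ δ {R} (M : Matroid n) → (∀ A → rk M A ≤ R) →
  (X Y : Fin p → Subset n) → (∀ i → HyperplanePair M R δ (X i) (Y i)) → Separable M X Y
hyperplane-pairs-separable {n} zero M rk≤R X Y H =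
  n , M , proj₁ (Extends-refl M) , λ {g} e i gX≤ gY≤ →
    subst (λ V → g V ≤ rk M (X i ∩ Y i)) (sym (ι-id (X i ∩ Y i))) (modular-meets (H i) e
      (subst (λ V → g V ≤ rk M (X i)) (ι-id (X i)) gX≤)
      (subst (λ V → g V ≤ rk M (Y i)) (ι-id (Y i)) gY≤))
  where
  ι-id : ∀ A → ι (proj₁ (Extends-refl M)) A ≡ A
  ι-id = proj₂ (Extends-refl M)
hyperplane-pairs-separable (suc δ) M rk≤R X Y H = Separable-lift M≼N skew-meets
  (hyperplane-pairs-separable δ N N-bound (C ∘ (_, true)) (C ∘ (_, false)) doubled)
  where open Doubling M rk≤R X Y H

-- From incomparable flats to hyperplanes

-- Adding disjoint sets of free elements to X and Y makes both of them hyperplanes of a matroid of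
-- the same rank, without enlarging their intersection.
module FreeHyperplanes {n R : ℕ} (M : Matroid n) (rk≤R : ∀ A → rk M A ≤ suc R) {X Y : Subset n}
  (X-cl : Closed M X) (Y-cl : Closed M Y) (X⊈Y : ¬ X ⊆ Y) (Y⊈X₀ : ¬ Y ⊆ X)
  (rX≤R : rk M X ≤ R) (rY≤R : rk M Y ≤ R)
  where

  -- The numbers of free elements that lift `X` and `Y` to rank `R`; the subtractions are exact by
  -- `rX≤R` and `rY≤R`.
  p₁ p₂ : ℕ
  p₁ = R ∸ rk M X
  p₂ = R ∸ rk M Y

  U V : Subset (p₁ + p₂)
  U = ⊤ {p₁} ++ ⊥ {p₂}
  V = ⊥ {p₁} ++ ⊤ {p₂}

  ∣U∣ : ∣ U ∣ ≡ p₁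
  ∣U∣ = trans (∣++∣ (⊤ {p₁}) ⊥) (trans (cong₂ _+_ (∣⊤∣≡n p₁) (∣⊥∣≡0 p₂)) (+-identityʳ p₁))

  ∣V∣ : ∣ V ∣ ≡ p₂
  ∣V∣ = trans (∣++∣ (⊥ {p₁}) ⊤) (cong₂ _+_ (∣⊥∣≡0 p₁) (∣⊤∣≡n p₂))

  U∩V : U ∩ V ≡ ⊥
  U∩V = trans (++-∩ (⊤ {p₁}) (⊥ {p₁}) {⊥ {p₂}} {⊤})
    (trans (cong₂ _++_ (∩-identityˡ (⊥ {p₁})) (∩-identityʳ (⊥ {p₂}))) (sym (⊥-++ p₁)))

  -- With an empty family of prescribed hyperplanes this is the plain truncation to rank `suc R`.
  open Paving (M ⊕free (p₁ + p₂)) R {J = Empty} (λ ()) (λ A → no λ ()) (λ ()) (λ ())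

  N : Matroid (n + (p₁ + p₂))
  N = paved

  rk-N : ∀ {A S} → rk M A + ∣ S ∣ ≤ suc R → rk N (A ++ S) ≡ rk M A + ∣ S ∣
  rk-N {A} {S} le = trans (m≤n⇒m⊓n≡m (≤-trans (≤-reflexive (rk-⊕free M A S)) le)) (rk-⊕free M A S)

  rk-N-⊥ : ∀ A → rk N (A ++ ⊥) ≡ rk M A
  rk-N-⊥ A = trans (rk-N (≤-trans (≤-reflexive rA+0) (rk≤R A))) rA+0
    where
    rA+0 : rk M A + ∣ ⊥ {p₁ + p₂} ∣ ≡ rk M A
    rA+0 = trans (cong (rk M A +_) (∣⊥∣≡0 (p₁ + p₂))) (+-identityʳ _)

  M≼N : Extends M N
  M≼N = extends refl rk-N-⊥

  rk-N-hyperplane : ∀ {A S} → rk M A + ∣ S ∣ ≡ R → rk N (A ++ S) ≡ R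
  rk-N-hyperplane eq = trans (rk-N (≤-trans (≤-reflexive eq) (n≤1+n R))) eq

  rk-XU : rk N (X ++ U) ≡ R
  rk-XU = rk-N-hyperplane (trans (cong (rk M X +_) ∣U∣) (m+[n∸m]≡n rX≤R))

  rk-YV : rk N (Y ++ V) ≡ R
  rk-YV = rk-N-hyperplane (trans (cong (rk M Y +_) ∣V∣) (m+[n∸m]≡n rY≤R))

  closed-N : ∀ {A S} → Closed M A → rk N (A ++ S) ≡ R → Closed N (A ++ S)
  closed-N {A} {S} A-closed eq = paved-closed (closed-⊕free M A-closed S)
    (λ ⊆AS → ≤-trans (rk-mono N _ _ ⊆AS) (≤-reflexive eq)) (λ ())

  XU∩YV : (X ++ U) ∩ (Y ++ V) ≡ (X ∩ Y) ++ ⊥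
  XU∩YV = trans (++-∩ X Y) (cong ((X ∩ Y) ++_) U∩V)

  -- If the rank did not drop from `X` to `X ∩ Y`, then `X` would lie in the closed set `Y`. The
  -- inequality makes the subtraction in `δ` exact.
  rk-Z<R : rk M (X ∩ Y) < R
  rk-Z<R = <-≤-trans (≰⇒> λ le → X⊈Y (Y-cl (p∩q⊆p X Y) (p∩q⊆q X Y) le)) rX≤R

  δ : ℕ
  δ = R ∸ suc (rk M (X ∩ Y))

  hyperplanes : HyperplanePair N (suc R) δ (X ++ U) (Y ++ V)
  hyperplanes .X-closed = closed-N X-cl rk-XU
  hyperplanes .Y-closed = closed-N Y-cl rk-YV
  hyperplanes .rk-X     = cong suc rk-XU
  hyperplanes .rk-Y     = cong suc rk-YV
  hyperplanes .Y⊈X ⊆    = Y⊈X₀ (proj₁ (++-⊆⁻ {S = V} {U} ⊆))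
  hyperplanes .rk-X∩Y   = begin
    rk N ((X ++ U) ∩ (Y ++ V)) + (2 + δ)  ≡⟨ cong (_+ (2 + δ)) (trans (cong (rk N) XU∩YV) (rk-N-⊥ (X ∩ Y))) ⟩
    rk M (X ∩ Y) + (2 + δ)                ≡⟨ +-suc _ (suc δ) ⟩
    suc (rk M (X ∩ Y) + suc δ)            ≡⟨ cong suc (+-suc _ δ) ⟩
    suc (suc (rk M (X ∩ Y)) + δ)          ≡⟨ cong suc (m+[n∸m]≡n rk-Z<R) ⟩
    suc R                                 ∎
    where open ≡-Reasoning

  spanned-++ : ∀ {g} (e : Point N g) {A} S → Point-restrict M≼N e spanned-by A → e spanned-by (A ++ S)
  spanned-++ e {A} S gA≤ = spanned-mono e (++-⊆ {A = A} ⊆-refl (⊆-min S))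
    (≤-trans gA≤ (≤-reflexive (sym (rk-N-⊥ A))))

  meets-restrict : ∀ {g} (e : Point N g) → Meets-in-closure e (X ++ U) (Y ++ V) →
                   Meets-in-closure (Point-restrict M≼N e) X Y
  meets-restrict {g} e meets gX≤ gY≤ = subst₂ _≤_ (cong g XU∩YV)
    (trans (cong (rk N) XU∩YV) (rk-N-⊥ (X ∩ Y)))
    (meets (spanned-++ e U gX≤) (spanned-++ e V gY≤))

  separable : Separable {p = 1} M (λ _ → X) (λ _ → Y)
  separable = Separable-lift M≼N (λ e meets _ → meets-restrict e (meets zero))
    (hyperplane-pairs-separable {p = 1} δ N f≤1+k (λ _ → X ++ U) (λ _ → Y ++ V) (λ _ → hyperplanes))

closed-pair-separable : (M : Matroid n) {X Y : Subset n} → Closed M X → Closed M Y →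
  ¬ X ⊆ Y → ¬ Y ⊆ X → Separable {p = 1} M (λ _ → X) (λ _ → Y)
closed-pair-separable {n} M {X} {Y} X-cl Y-cl X⊈Y Y⊈X =
  -- Incomparable closed sets are proper, so `rk M ⊤` is positive and `suc R` is exactly `rk M ⊤`.
  FreeHyperplanes.separable {R = rk M ⊤ ∸ 1} M
    (λ A → ≤-trans (rk-mono M _ _ (⊆-max A)) (≤-reflexive (sym 1+R)))
    X-cl Y-cl X⊈Y Y⊈X (below rX<) (below (proper Y-cl X⊈Y))
  where
  proper : ∀ {A B} → Closed M A → ¬ B ⊆ A → rk M A < rk M ⊤
  proper {A} {B} A-cl B⊈A = ≰⇒> λ le → B⊈A (⊆-trans (⊆-max B) (A-cl (⊆-max A) ⊆-refl le))
  rX< : rk M X < rk M ⊤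
  rX< = proper X-cl Y⊈X
  1+R : suc (rk M ⊤ ∸ 1) ≡ rk M ⊤
  1+R = m+[n∸m]≡n (≤-trans (s≤s z≤n) rX<)
  below : ∀ {a} → a < rk M ⊤ → a ≤ rk M ⊤ ∸ 1
  below a< = ≤-pred (≤-trans a< (≤-reflexive (sym 1+R)))

-- Flats and closures

∣∣<∣∪⁅⁆∣ : ∀ {A : Subset n} {e} → e ∉ A → ∣ A ∣ < ∣ A ∪ ⁅ e ⁆ ∣
∣∣<∣∪⁅⁆∣ {A = A} {e} e∉A = p⊂q⇒∣p∣<∣q∣ (p⊆p∪q ⁅ e ⁆ , e , q⊆p∪q A ⁅ e ⁆ (x∈⁅x⁆ e) , e∉A)

-- For `e` in `B` outside `X`, submodularity at `X` and `A ∪ ⁅ e ⁆` carries the failure of `e` to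
-- raise the rank of `A` over to `X`.
flat⇒closed : (M : Matroid n) {X : Subset n} → IsFlat M X → Closed M X
flat⇒closed M {X} X-flat {A} {B} A⊆B A⊆X rB≤rA {e} e∈B with e ∈? X
... | yes e∈X = e∈X
... | no  e∉X = contradiction (X-flat e e∉X) (≤⇒≯ (+-cancelʳ-≤ (rk M A) _ _ (begin
  rk M (X ∪ ⁅ e ⁆) + rk M A                    ≤⟨ +-mono-≤
      (rk-mono M _ _ (∪-mono ⊆-refl (q⊆p∪q A ⁅ e ⁆)))
      (rk-mono M _ _ (∩-glb A⊆X (p⊆p∪q ⁅ e ⁆))) ⟩
  rk M (X ∪ (A ∪ ⁅ e ⁆)) + rk M (X ∩ (A ∪ ⁅ e ⁆))  ≤⟨ rk-sub M X (A ∪ ⁅ e ⁆) ⟩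
  rk M X + rk M (A ∪ ⁅ e ⁆)                    ≤⟨ +-monoʳ-≤ (rk M X)
      (≤-trans (rk-mono M _ _ (∪-lub A⊆B e⊆B)) rB≤rA) ⟩
  rk M X + rk M A                              ∎)))
  where
  open ≤-Reasoning
  e⊆B : ⁅ e ⁆ ⊆ B
  e⊆B x∈ with refl ← x∈⁅y⁆⇒x≡y e x∈ = e∈B

closed⇒flat : (M : Matroid n) {X : Subset n} → Closed M X → IsFlat M X
closed⇒flat M {X} X-closed e e∉X = ≰⇒> λ le →
  e∉X (X-closed (p⊆p∪q ⁅ e ⁆) ⊆-refl le (q⊆p∪q X ⁅ e ⁆ (x∈⁅x⁆ e)))

closed-∩ : (M : Matroid n) {X Y : Subset n} → Closed M X → Closed M Y → Closed M (X ∩ Y)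
closed-∩ M {X} {Y} X-closed Y-closed A⊆B A⊆X∩Y rB≤rA = ∩-glb
  (X-closed A⊆B (⊆-trans A⊆X∩Y (p∩q⊆p X Y)) rB≤rA)
  (Y-closed A⊆B (⊆-trans A⊆X∩Y (p∩q⊆q X Y)) rB≤rA)

closure : (M : Matroid n) (A : Subset n) → ∃ λ F → IsFlat M F × A ⊆ F × rk M F ≤ rk M A
closure {n} M A = grow n A (m≤m+n n ∣ A ∣)
  where
  -- Elements that do not raise the rank are added greedily. The fuel bounds the number of elements
  -- outside `A`, so at `zero` none is left to add.
  grow : ∀ fuel A → n ≤ fuel + ∣ A ∣ → ∃ λ F → IsFlat M F × A ⊆ F × rk M F ≤ rk M A
  grow fuel A le with any? (λ e → ¬? (e ∈? A) ×-dec (rk M (A ∪ ⁅ e ⁆) ≤? rk M A))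
  ... | no  none = A , (λ e e∉A → ≰⇒> λ r≤ → none (e , e∉A , r≤)) , ⊆-refl , ≤-refl
  grow zero A le | yes (e , e∉A , r≤) = contradiction
    (<-≤-trans (∣∣<∣∪⁅⁆∣ e∉A) (∣p∣≤n (A ∪ ⁅ e ⁆))) (≤⇒≯ le)
  grow (suc fuel) A le | yes (e , e∉A , r≤)
    with F , F-flat , ⊆F , rF≤ ← grow fuel (A ∪ ⁅ e ⁆)
           (≤-trans le (≤-trans (≤-reflexive (sym (+-suc fuel ∣ A ∣))) (+-monoʳ-≤ fuel (∣∣<∣∪⁅⁆∣ e∉A))))
    = F , F-flat , ⊆-trans (p⊆p∪q ⁅ e ⁆) ⊆F , ≤-trans rF≤ r≤

-- The one-point extension given by a modular cut

module CutExtension (M : Matroid n) (𝓜 : Subset n → Bool) (𝓜-cut : IsModularCut M 𝓜) where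

  𝓜-flat : ∀ {F} → T (𝓜 F) → IsFlat M F
  𝓜-flat = proj₁ 𝓜-cut _

  𝓜-up : ∀ {F F′} → T (𝓜 F) → IsFlat M F′ → F ⊆ F′ → T (𝓜 F′)
  𝓜-up = proj₁ (proj₂ 𝓜-cut) _ _

  𝓜-meet : ∀ {F F′} → T (𝓜 F) → T (𝓜 F′) → ModularPair M F F′ → T (𝓜 (F ∩ F′))
  𝓜-meet = proj₂ (proj₂ 𝓜-cut) _ _

  -- Says that the closure of `A` belongs to `𝓜`. In this form no closure has to be chosen, and a
  -- search over all subsets decides it.
  Spans : Subset n → Set
  Spans A = ∃ λ F → T (𝓜 F) × rk M (A ∪ F) ≤ rk M A

  spans? : ∀ A → Dec (Spans A)
  spans? A = anySubset? λ F → T? (𝓜 F) ×-dec (rk M (A ∪ F) ≤? rk M A)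

  member-spans : ∀ {A} → T (𝓜 A) → Spans A
  member-spans {A} A∈ = A , A∈ , ≤-reflexive (cong (rk M) (∪-idem A))

  spans-up : ∀ {A B} → A ⊆ B → Spans A → Spans B
  spans-up {A} {B} A⊆B (F , F∈ , le) = F , F∈ , +-cancelʳ-≤ (rk M A) _ _ (begin
    rk M (B ∪ F) + rk M A                    ≤⟨ +-mono-≤
        (rk-mono M _ _ (∪-mono ⊆-refl (q⊆p∪q A F)))
        (rk-mono M _ _ (∩-glb A⊆B (p⊆p∪q F))) ⟩
    rk M (B ∪ (A ∪ F)) + rk M (B ∩ (A ∪ F))  ≤⟨ rk-sub M B (A ∪ F) ⟩
    rk M B + rk M (A ∪ F)                    ≤⟨ +-monoʳ-≤ (rk M B) le ⟩
    rk M B + rk M A                          ∎)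
    where open ≤-Reasoning

  spans-down : ∀ {A B} → A ⊆ B → rk M B ≤ rk M A → Spans B → Spans A
  spans-down A⊆B rB≤rA (F , F∈ , le) =
    F , F∈ , ≤-trans (rk-mono M _ _ (∪-mono A⊆B ⊆-refl)) (≤-trans le rB≤rA)

  flat-spans : ∀ {A} → IsFlat M A → Spans A → T (𝓜 A)
  flat-spans {A} A-flat (F , F∈ , le) = 𝓜-up F∈ A-flat
    (⊆-trans (q⊆p∪q A F) (flat⇒closed M A-flat (p⊆p∪q F) ⊆-refl le))

  -- The closures `F` and `G` of `A` and `B` belong to `𝓜`. Equality in submodularity would make
  -- them a modular pair with `F ∩ G` of the same rank as `A ∩ B`, so `A ∩ B` would span the member
  -- `F ∩ G`.
  spans-∩ : ∀ {A B} → Spans A → Spans B → ¬ Spans (A ∩ B) →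
            rk M (A ∪ B) + rk M (A ∩ B) < rk M A + rk M B
  spans-∩ {A} {B} A-spans B-spans ¬spans = ≰⇒> λ le → ¬spans (modular-case le)
    where
    module _ (le : rk M A + rk M B ≤ rk M (A ∪ B) + rk M (A ∩ B)) where
      F′ G′ : ∃ λ F → IsFlat M F × _
      F′ = closure M A
      G′ = closure M B
      F G : Subset n
      F = proj₁ F′
      G = proj₁ G′
      A⊆F : A ⊆ F
      A⊆F = proj₁ (proj₂ (proj₂ F′))
      B⊆G : B ⊆ G
      B⊆G = proj₁ (proj₂ (proj₂ G′))
      F∈ : T (𝓜 F)
      F∈ = flat-spans (proj₁ (proj₂ F′)) (spans-up A⊆F A-spans)
      G∈ : T (𝓜 G)
      G∈ = flat-spans (proj₁ (proj₂ G′)) (spans-up B⊆G B-spans)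
      sum≤ : rk M F + rk M G ≤ rk M (A ∪ B) + rk M (A ∩ B)
      sum≤ = ≤-trans (+-mono-≤ (proj₂ (proj₂ (proj₂ F′))) (proj₂ (proj₂ (proj₂ G′)))) le
      ∪≤ : rk M (A ∪ B) ≤ rk M (F ∪ G)
      ∪≤ = rk-mono M _ _ (∪-mono A⊆F B⊆G)
      ∩≤ : rk M (A ∩ B) ≤ rk M (F ∩ G)
      ∩≤ = rk-mono M _ _ (∩-mono A⊆F B⊆G)
      modular : ModularPair M F G
      modular = ≤-antisym (≤-trans sum≤ (+-mono-≤ ∪≤ ∩≤)) (rk-sub M F G)
      ∩≥ : rk M (F ∩ G) ≤ rk M (A ∩ B)
      ∩≥ = +-cancelˡ-≤ (rk M (F ∪ G)) _ _
        (≤-trans (rk-sub M F G) (≤-trans sum≤ (+-monoˡ-≤ _ ∪≤)))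
      modular-case : Spans (A ∩ B)
      modular-case = spans-down (∩-mono A⊆F B⊆G) ∩≥ (member-spans (𝓜-meet F∈ G∈ modular))

  gap : Subset n → ℕ
  gap A with spans? A
  ... | yes _ = 0
  ... | no  _ = 1

  gap-spans : ∀ {A} → Spans A → gap A ≡ 0
  gap-spans {A} A-spans with spans? A
  ... | yes _ = refl
  ... | no  ¬s = contradiction A-spans ¬s

  gap-¬spans : ∀ {A} → ¬ Spans A → gap A ≡ 1
  gap-¬spans {A} ¬s with spans? A
  ... | yes s = contradiction s ¬s
  ... | no  _ = refl

  gap≤1 : ∀ A → gap A ≤ 1
  gap≤1 A with spans? A
  ... | yes _ = z≤n
  ... | no  _ = ≤-refl

  gap-anti : ∀ {A B} → A ⊆ B → gap B ≤ gap A
  gap-anti {A} {B} A⊆B with spans? A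
  ... | yes A-spans = ≤-reflexive (gap-spans (spans-up A⊆B A-spans))
  ... | no  _       = gap≤1 B

  -- The rank of `A ∪ {e}` in Crapo's single-element extension for `𝓜`.
  r⁺ : Subset n → ℕ
  r⁺ A = rk M A + gap A

  r⁺-mono : ∀ {A B} → A ⊆ B → r⁺ A ≤ r⁺ B
  r⁺-mono {A} {B} A⊆B = go (rk M B ≤? rk M A) (spans? B)
    where
    open ≤-Reasoning
    -- The gap can fall by one from `A` to `B`, but only if the rank rises; otherwise a member
    -- spanned by `B` is spanned by `A` too.
    go : Dec (rk M B ≤ rk M A) → Dec (Spans B) → r⁺ A ≤ r⁺ B
    go (no  lt) _             = begin
      rk M A + gap A  ≤⟨ +-monoʳ-≤ (rk M A) (gap≤1 A) ⟩
      rk M A + 1      ≡⟨ +-comm (rk M A) 1 ⟩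
      suc (rk M A)    ≤⟨ ≰⇒> lt ⟩
      rk M B          ≤⟨ m≤m+n (rk M B) (gap B) ⟩
      rk M B + gap B  ∎
    go (yes le) (yes B-spans) = +-mono-≤ (rk-mono M _ _ A⊆B)
      (≤-trans (≤-reflexive (gap-spans (spans-down A⊆B le B-spans))) z≤n)
    go (yes le) (no  ¬s)      = +-mono-≤ (rk-mono M _ _ A⊆B)
      (≤-trans (gap≤1 A) (≤-reflexive (sym (gap-¬spans ¬s))))

  -- The gap alone is submodular unless `A` and `B` span members and `A ∩ B` does not; in that case
  -- `spans-∩` supplies the missing one.
  r⁺-sub : ∀ A B → r⁺ (A ∪ B) + r⁺ (A ∩ B) ≤ r⁺ A + r⁺ B
  r⁺-sub A B = subst₂ _≤_ (+-interchange (rk M (A ∪ B)) (rk M (A ∩ B)) _ _) (+-interchange (rk M A) (rk M B) _ _)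
    (go (spans? A) (spans? B) (spans? (A ∩ B)))
    where
    open ≤-Reasoning
    le : rk M (A ∪ B) + rk M (A ∩ B) ≤ rk M A + rk M B
    le = rk-sub M A B
    go : Dec (Spans A) → Dec (Spans B) → Dec (Spans (A ∩ B)) →
         (rk M (A ∪ B) + rk M (A ∩ B)) + (gap (A ∪ B) + gap (A ∩ B)) ≤
         (rk M A + rk M B) + (gap A + gap B)
    go (no ¬A) _ _ = +-mono-≤ le (≤-trans (≤-reflexive (+-comm (gap (A ∪ B)) _))
      (+-mono-≤ (≤-trans (gap≤1 _) (≤-reflexive (sym (gap-¬spans ¬A)))) (gap-anti (q⊆p∪q A B))))
    go _ (no ¬B) _ = +-mono-≤ le (+-mono-≤ (gap-anti (p⊆p∪q B))
      (≤-trans (gap≤1 _) (≤-reflexive (sym (gap-¬spans ¬B)))))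
    go (yes A-spans) _ (yes ∩-spans) = +-mono-≤ le (≤-trans
      (≤-reflexive (cong₂ _+_ (gap-spans (spans-up (p⊆p∪q B) A-spans)) (gap-spans ∩-spans))) z≤n)
    go (yes A-spans) (yes B-spans) (no ¬∩) = begin
      (rk M (A ∪ B) + rk M (A ∩ B)) + (gap (A ∪ B) + gap (A ∩ B))
        ≡⟨ cong₂ (λ a b → (rk M (A ∪ B) + rk M (A ∩ B)) + (a + b))
             (gap-spans (spans-up (p⊆p∪q B) A-spans)) (gap-¬spans ¬∩) ⟩
      (rk M (A ∪ B) + rk M (A ∩ B)) + 1    ≡⟨ +-comm _ 1 ⟩
      suc (rk M (A ∪ B) + rk M (A ∩ B))    ≤⟨ spans-∩ A-spans B-spans ¬∩ ⟩
      rk M A + rk M B                      ≤⟨ m≤m+n _ _ ⟩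
      (rk M A + rk M B) + (gap A + gap B)  ∎

  ρ : Subset n → Subset 1 → ℕ
  ρ A (outside ∷ []) = rk M A
  ρ A (inside  ∷ []) = r⁺ A

  r≤r⁺ : ∀ A → rk M A ≤ r⁺ A
  r≤r⁺ A = m≤m+n (rk M A) (gap A)

  ρ-card : ∀ A S → ρ A S ≤ ∣ A ∣ + ∣ S ∣
  ρ-card A (outside ∷ []) = ≤-trans (rk-card M A) (m≤m+n ∣ A ∣ 0)
  ρ-card A (inside  ∷ []) = +-mono-≤ (rk-card M A) (gap≤1 A)

  ρ-mono : ∀ {A B S U} → A ⊆ B → S ⊆ U → ρ A S ≤ ρ B U
  ρ-mono {S = outside ∷ []} {outside ∷ []} A⊆B S⊆U = rk-mono M _ _ A⊆B
  ρ-mono {B = B} {outside ∷ []} {inside ∷ []} A⊆B S⊆U = ≤-trans (rk-mono M _ _ A⊆B) (r≤r⁺ B)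
  ρ-mono {S = inside ∷ []} {inside ∷ []} A⊆B S⊆U = r⁺-mono A⊆B
  ρ-mono {S = inside ∷ []} {outside ∷ []} A⊆B S⊆U with () ← S⊆U here

  ρ-sub : ∀ A B S U → ρ (A ∪ B) (S ∪ U) + ρ (A ∩ B) (S ∩ U) ≤ ρ A S + ρ B U
  ρ-sub A B (outside ∷ []) (outside ∷ []) = rk-sub M A B
  ρ-sub A B (outside ∷ []) (inside  ∷ []) = begin
    (rk M (A ∪ B) + gap (A ∪ B)) + rk M (A ∩ B)   ≡⟨ arith (rk M (A ∪ B)) _ _ ⟩
    (rk M (A ∪ B) + rk M (A ∩ B)) + gap (A ∪ B)   ≤⟨ +-mono-≤ (rk-sub M A B) (gap-anti (q⊆p∪q A B)) ⟩
    (rk M A + rk M B) + gap B                     ≡⟨ +-assoc (rk M A) _ _ ⟩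
    rk M A + (rk M B + gap B)                     ∎
    where
    open ≤-Reasoning
    arith : ∀ a b c → (a + b) + c ≡ (a + c) + b
    arith = solve 3 (λ a b c → (a :+ b) :+ c := (a :+ c) :+ b) refl where open +-*-Solver
  ρ-sub A B (inside  ∷ []) (outside ∷ []) = subst₂ _≤_
    (cong₂ (λ V W → r⁺ V + rk M W) (∪-comm B A) (∩-comm B A)) (+-comm (rk M B) (r⁺ A))
    (ρ-sub B A (outside ∷ []) (inside ∷ []))
  ρ-sub A B (inside  ∷ []) (inside  ∷ []) = r⁺-sub A B

  M⁺ : Matroid (n + 1)
  M⁺ = ρ-matroid ρ ρ-card ρ-mono ρ-sub

  rk-M⁺ : ∀ A S → rk M⁺ (A ++ S) ≡ ρ A S
  rk-M⁺ = rk-ρ-matroid ρ ρ-card ρ-mono ρ-sub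

-- From an amalgam to a principal cut

module AmalgamPoint {N₁ : Matroid (n + 1)} {N₂ : Matroid (n + k)} (P : Matroid (n + 1 + k))
  (P-amalgam : IsAmalgam {n} {1} {k} N₁ N₂ P)
  where

  -- The amalgam lists the elements of `M`, then `e`, then the rest of `N₂`, so `e` has to be put in
  -- the middle; `b` says whether it belongs to the set.
  insert : Bool → Subset (n + k) → Subset (n + 1 + k)
  insert b W = (take n W ++ (b ∷ [])) ++ drop n W

  insert-++ : ∀ b (A : Subset n) (S : Subset k) → insert b (A ++ S) ≡ (A ++ (b ∷ [])) ++ S
  insert-++ b A S = cong₂ (λ B U → (B ++ (b ∷ [])) ++ U) (take-++ A S) (drop-++ A S)

  insert-∪ : ∀ b c V W → insert b V ∪ insert c W ≡ insert (b ∨ c) (V ∪ W)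
  insert-∪ b c V W
    rewrite take-zipWith {m = n} _∨_ V W | drop-zipWith {m = n} _∨_ V W
    = trans (++-∪ (take n V ++ (b ∷ [])) (take n W ++ (c ∷ [])))
        (cong (_++ (drop n V ∪ drop n W)) (++-∪ (take n V) (take n W)))

  insert-∩ : ∀ b c V W → insert b V ∩ insert c W ≡ insert (b ∧ c) (V ∩ W)
  insert-∩ b c V W
    rewrite take-zipWith {m = n} _∧_ V W | drop-zipWith {m = n} _∧_ V W
    = trans (++-∩ (take n V ++ (b ∷ [])) (take n W ++ (c ∷ [])))
        (cong (_++ (drop n V ∩ drop n W)) (++-∩ (take n V) (take n W)))

  insert-⊆ : ∀ b {V W} → V ⊆ W → insert b V ⊆ insert b W
  insert-⊆ b V⊆W = ++-⊆ (++-⊆ (take-⊆ n V⊆W) ⊆-refl) (drop-⊆ n V⊆W)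

  rk-outside : ∀ W → rk P (insert outside W) ≡ rk N₂ W
  rk-outside W = trans (proj₂ P-amalgam (take n W) (drop n W)) (cong (rk N₂) (take++drop≡id n W))

  g : Subset (n + k) → ℕ
  g W = rk P (insert inside W)

  g-++⊥ : ∀ (A : Subset n) → g (A ++ ⊥) ≡ rk N₁ (A ++ (inside ∷ []))
  g-++⊥ A = trans (cong (rk P) (insert-++ inside A ⊥)) (proj₁ P-amalgam _)

  point : Point N₂ g
  point .above W = ≤-trans (≤-reflexive (sym (rk-outside W)))
    (rk-mono P _ _ (++-⊆ {S = drop n W} (++-⊆ {A = take n W} ⊆-refl (⊆-min (inside ∷ []))) ⊆-refl))
  point .sub V W = subst₂ (λ A B → rk P A + rk P B ≤ g V + g W)
    (insert-∪ inside inside V W) (insert-∩ inside inside V W) (rk-sub P _ _)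
  -- Submodularity of `P` at `V ∪ {e}` and `W`; as `V ⊆ W`, the union is `W ∪ {e}` and the meet is
  -- `V`.
  point .mixed {V} {W} V⊆W = begin
    g W + rk N₂ V
      ≤⟨ +-mono-≤ (rk-mono P _ _ (insert-⊆ inside (q⊆p∪q V W))) (≤-reflexive (sym (rk-outside V))) ⟩
    g (V ∪ W) + rk P (insert outside V)
      ≤⟨ +-monoʳ-≤ (g (V ∪ W)) (rk-mono P _ _ (insert-⊆ outside (∩-glb ⊆-refl V⊆W))) ⟩
    g (V ∪ W) + rk P (insert outside (V ∩ W))
      ≡⟨ cong₂ (λ A B → rk P A + rk P B) (insert-∪ inside outside V W) (insert-∩ inside outside V W) ⟨
    rk P (insert inside V ∪ insert outside W) + rk P (insert inside V ∩ insert outside W)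
      ≤⟨ rk-sub P _ _ ⟩
    g V + rk P (insert outside W)
      ≡⟨ cong (g V +_) (rk-outside W) ⟩
    g V + rk N₂ W ∎
    where open ≤-Reasoning

module StickyCut (M : Matroid n) (M-sticky : Sticky M) (𝓜 : Subset n → Bool) (𝓜-cut : IsModularCut M 𝓜) where

  open CutExtension M 𝓜 𝓜-cut

  -- In an amalgam of `M⁺` with the separating extension, `e` gives a point whose `g` restricts to
  -- `r⁺` on `M`. Separation forces `r⁺ (X ∩ Y)` down to `rk M (X ∩ Y)`, so the gap there cannot be
  -- 1.
  spans-meet : ∀ {X Y} → Separable {p = 1} M (λ _ → X) (λ _ → Y) → Spans X → Spans Y → Spans (X ∩ Y)
  spans-meet {X} {Y} (_ , N , extends {k} refl rk-N , meets) X-spans Y-spans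
    with P , P-amalgam ← M-sticky 1 k M⁺ N (λ A → rk-M⁺ A ⊥) rk-N
    = decide (spans? (X ∩ Y))
    where
    open AmalgamPoint {N₁ = M⁺} {N} P P-amalgam
    g≡r⁺ : ∀ A → g (A ++ ⊥) ≡ r⁺ A
    g≡r⁺ A = trans (g-++⊥ A) (rk-M⁺ A (inside ∷ []))
    spans⇒g≤ : ∀ {A} → Spans A → g (A ++ ⊥) ≤ rk M A
    spans⇒g≤ {A} s = ≤-reflexive (trans (g≡r⁺ A) (trans (cong (rk M A +_) (gap-spans s)) (+-identityʳ _)))
    decide : Dec (Spans (X ∩ Y)) → Spans (X ∩ Y)
    decide (yes s) = s
    decide (no ¬s) = contradiction (meets point zero (spans⇒g≤ X-spans) (spans⇒g≤ Y-spans))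
      (<⇒≱ (≤-reflexive (sym (trans (g≡r⁺ (X ∩ Y))
        (trans (cong (rk M (X ∩ Y) +_) (gap-¬spans ¬s)) (+-comm _ 1))))))

  -- Separation needs incomparable sets; for comparable ones the meet is one of the two.
  ∩-member : ∀ {X Y} → T (𝓜 X) → T (𝓜 Y) → T (𝓜 (X ∩ Y))
  ∩-member {X} {Y} X∈ Y∈ with X ⊆? Y | Y ⊆? X
  ... | yes X⊆Y | _       = subst (T ∘ 𝓜) (⊆-antisym (∩-glb ⊆-refl X⊆Y) (p∩q⊆p X Y)) X∈
  ... | no  _   | yes Y⊆X = subst (T ∘ 𝓜) (⊆-antisym (∩-glb Y⊆X ⊆-refl) (p∩q⊆q X Y)) Y∈
  ... | no  X⊈Y | no  Y⊈X = flat-spans (closed⇒flat M (closed-∩ M X-cl Y-cl))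
    (spans-meet (closed-pair-separable M X-cl Y-cl X⊈Y Y⊈X) (member-spans X∈) (member-spans Y∈))
    where
    X-cl : Closed M X
    X-cl = flat⇒closed M (𝓜-flat X∈)
    Y-cl : Closed M Y
    Y-cl = flat⇒closed M (𝓜-flat Y∈)

  -- As long as some member `G` does not contain `F`, the member `F ∩ G` is strictly smaller, so
  -- `∣ F ∣` rounds suffice.
  least : ∀ fuel F → ∣ F ∣ ≤ fuel → T (𝓜 F) → ∃ λ F₀ → T (𝓜 F₀) × (∀ G → T (𝓜 G) → F₀ ⊆ G)
  least fuel F F≤ F∈ with anySubset? (λ G → T? (𝓜 G) ×-dec ¬? (F ⊆? G))
  ... | no none = F , F∈ , λ G G∈ → decidable-stable (F ⊆? G) λ F⊈G → none (G , G∈ , λ ⊆G → F⊈G ⊆G)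
  ... | yes (G , G∈ , F⊈G) = descend fuel F≤
    where
    smaller : ∣ F ∩ G ∣ < ∣ F ∣
    smaller = ≰⇒> λ le → F⊈G (⊆-trans (⊆∧∣∣≤⇒⊇ (p∩q⊆p F G) le) (p∩q⊆q F G))
    descend : ∀ fuel → ∣ F ∣ ≤ fuel → ∃ λ F₀ → T (𝓜 F₀) × (∀ G → T (𝓜 G) → F₀ ⊆ G)
    descend zero    le = contradiction (<-≤-trans smaller le) λ ()
    descend (suc c) le = least c (F ∩ G) (≤-pred (<-≤-trans smaller le)) (∩-member F∈ G∈)

  principal : ¬ IsEmptyCut M 𝓜 → IsPrincipal M 𝓜
  principal nonempty with anySubset? (λ F → T? (𝓜 F))
  ... | no  none     = contradiction (λ F F∈ → none (F , F∈)) nonempty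
  ... | yes (F , F∈) with F₀ , F₀∈ , F₀-least ← least ∣ F ∣ F ≤-refl F∈ =
    F₀ , 𝓜-flat F₀∈ , λ G → (λ G∈ → 𝓜-flat G∈ , F₀-least G G∈) , λ (G-flat , F₀⊆G) → 𝓜-up F₀∈ G-flat F₀⊆G

theorem9 : (n : ℕ) (M : Matroid n) → ¬ OTE M → ¬ Sticky M
theorem9 n M ¬OTE M-sticky = ¬OTE λ 𝓜 𝓜-cut → StickyCut.principal M M-sticky 𝓜 𝓜-cut
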